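{- For every positive integer $k$, the class of graphs with tree-independence number at most $k$ is $(\mathrm{tw},\omega)$-bounded, with a $(\mathrm{tw},\omega)$-binding function $f(p) = R(p+1,k+1)-2$, and this function $f$ is upper-bounded by a polynomial in $p$ of degree $k$.
   Context: All graphs are finite, simple, and undirected. A tree decomposition of a graph $G$ is a pair $\mathcal{T}=(T,\{X_t\}_{t\in V(T)})$ where $T$ is a tree and each node $t$ is assigned a set (bag) $X_t\subseteq V(G)$ such that every vertex of $G$ is in at least one bag, every edge of $G$ has both endpoints in some common bag, and for every $u\in V(G)$ the subgraph of $T$ induced by $\{t: u\in X_t\}$ is connected. Its width is $\max_t |X_t|-1$, and the treewidth $\mathrm{tw}(G)$ is the minimum width of a tree decomposition of $G$. The independence number of $\mathcal{T}$ is $\alpha(\mathcal{T})=\max_{t\in V(T)}\alpha(G[X_t])$, where $\alpha(H)$ is the maximum size of an independent set in $H$. The tree-independence number $\mathsf{tree}\text{ - }\alpha(G)$ is the minimum of $\alpha(\mathcal{T})$ over all tree decompositions $\mathcal{T}$ of $G$. The clique number of $G$ is denoted $\omega(G)$. A graph class $\mathcal{G}$ is $(\mathrm{tw},\omega)$-bounded if it admits a $(\mathrm{tw},\omega)$-binding function, that is, a function $f$ such that for every $G\in\mathcal{G}$ and every induced subgraph $G'$ of $G$ we have $\mathrm{tw}(G')\le f(\omega(G'))$. For positive integers $p,q$, the Ramsey number $R(p,q)$ is the least positive integer $N$ such that every graph with at least $N$ vertices contains a clique of size $p$ or an independent set of size $q$. -}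

module Defs where

open import Data.Bool using (Bool; true; false; _∨_)
import Data.Bool.Properties as Bool
open import Data.Empty using (⊥-elim)
open import Data.Fin using (Fin; zero; suc; toℕ; fromℕ<; punchIn; punchOut; funToFin; finToFun)
open import Data.Fin.Properties using (_≟_; all?; any?; pigeonhole; toℕ<n; toℕ-fromℕ<; finToFun-funToFin; punchOut-punchIn; punchIn-punchOut; punchInᵢ≢i; punchOut-cong; 2↔Bool; <⇒≢)
open import Data.Fin.Subset using (Subset; inside; outside; _∈_; _∉_; _⊆_; ∣_∣; ⊥; ⊤; ⁅_⁆; _∪_; _∩_; _-_; ∁; Nonempty)
open import Data.Fin.Subset.Properties using (_∈?_; anySubset?; ∣p∣≤n; ∣⊥∣≡0; ∣⊤∣≡n; ∉⊥; ∈⊤; x∈⁅x⁆; x∈⁅y⁆⇒x≡y; x∈p∪q⁻; x∈p∩q⁻; x∈∁p⇒x∉p; p─⊥≡p; p─q⊆p; ∪-identityˡ)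
open import Data.Integer as ℤ using (ℤ; +_)
import Data.Integer.Properties as ℤ
open import Data.List as List using (List; []; _∷_; _∷ʳ_; length; allFin)
open import Data.List.Extrema.Nat using (max; max≤v⁺; xs≤max)
import Data.List.Membership.DecPropositional
open import Data.List.Membership.Propositional using () renaming (_∈_ to _∈ˡ_)
open import Data.List.Membership.Propositional.Properties using (∈-allFin)
open import Data.List.Relation.Unary.All as All using (All; []; _∷_)
import Data.List.Relation.Unary.All.Properties as All
open import Data.List.Relation.Unary.AllPairs using ([]; _∷_)
open import Data.List.Relation.Unary.Any using (here; there)
open import Data.List.Relation.Unary.Linked as Linked using (Linked; []; [-]; _∷_)
open import Data.List.Relation.Unary.Unique.Propositional using (Unique)
open import Data.Nat using (ℕ; zero; suc; _+_; _≤_; _<_; z≤n; s≤s; s≤s⁻¹; _^_)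
import Data.Nat.Properties as ℕ
open import Data.Product using (Σ; ∃; ∃-syntax; _×_; _,_; proj₁; proj₂)
open import Data.Rational as ℚ using (ℚ; 0ℚ)
open import Data.Sum using (_⊎_; inj₁; inj₂; [_,_]′)
open import Data.Vec as Vec using (Vec; []; _∷_; lookup; tabulate; here; there)
import Data.Vec.Properties as Vec
open import Function using (_∘_; id; Inverse)
open import Relation.Binary using (Decidable)
open import Relation.Binary.Construct.Closure.ReflexiveTransitive as Star using (Star; ε; _◅_; _◅◅_)
open import Relation.Binary.PropositionalEquality using (_≡_; _≢_; refl; sym; trans; cong; cong₂; subst; subst₂)
open import Relation.Nullary using (¬_; Dec; yes; no; contradiction)
open import Relation.Nullary.Decidable using (_×-dec_; _⊎-dec_; _→-dec_; ¬?; map′; decidable-stable; dec-true)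
import Relation.Unary as Unary

------------------------------------------------------------------------
-- Extrema

IsMaximum : {A : Set} → (A → ℕ) → ℕ → Set
IsMaximum f m = (∃[ a ] f a ≡ m) × (∀ a → f a ≤ m)

IsMinimum : {A : Set} → (A → ℕ) → ℕ → Set
IsMinimum f m = (∃[ a ] f a ≡ m) × (∀ a → m ≤ f a)

IsMinimumℤ : {A : Set} → (A → ℤ) → ℤ → Set
IsMinimumℤ f m = (∃[ a ] f a ≡ m) × (∀ a → m ℤ.≤ f a)

-- The 0 is harmless: this is only used for n > 0 and values in ℕ.
maxOver : {n : ℕ} → (Fin n → ℕ) → ℕ
maxOver f = max 0 (List.tabulate f)

------------------------------------------------------------------------
-- Graphs

record Graph (n : ℕ) : Set where
  field
    adj        : Fin n → Fin n → Bool
    adj-sym    : ∀ u v → adj u v ≡ adj v u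
    adj-irrefl : ∀ v → adj v v ≡ false

  Adj : Fin n → Fin n → Set
  Adj u v = adj u v ≡ true

open Graph public

-- The increasing enumeration of the elements of S.
member : ∀ {n} (S : Subset n) → Fin ∣ S ∣ → Fin n
member (outside ∷ S) i       = suc (member S i)
member (inside  ∷ S) zero    = zero
member (inside  ∷ S) (suc i) = suc (member S i)

infix 8 _[_]

-- The subgraph induced by S, its vertices renamed along member S.
_[_] : ∀ {n} → Graph n → (S : Subset n) → Graph ∣ S ∣
G [ S ] = record
  { adj        = λ u v → adj G (member S u) (member S v)
  ; adj-sym    = λ u v → adj-sym G (member S u) (member S v)
  ; adj-irrefl = λ v → adj-irrefl G (member S v)
  }

IsClique : ∀ {n} → Graph n → Subset n → Set
IsClique G S = ∀ u v → u ∈ S → v ∈ S → u ≢ v → Adj G u v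

IsIndependent : ∀ {n} → Graph n → Subset n → Set
IsIndependent G S = ∀ u v → u ∈ S → v ∈ S → ¬ Adj G u v

IsCliqueNumber : ∀ {n} → Graph n → ℕ → Set
IsCliqueNumber G = IsMaximum {A = ∃ (IsClique G)} (∣_∣ ∘ proj₁)

IsIndependenceNumber : ∀ {n} → Graph n → ℕ → Set
IsIndependenceNumber G = IsMaximum {A = ∃ (IsIndependent G)} (∣_∣ ∘ proj₁)

-- The graph without vertices counts as connected here; IsTree excludes it.
Connected : ∀ {n} → Graph n → Set
Connected G = ∀ u v → Star (Adj G) u v

IsCycle : ∀ {n} → Graph n → Fin n → List (Fin n) → Set
IsCycle G v vs = 2 ≤ length vs × Unique (v ∷ vs) × Linked (Adj G) (v ∷ vs ∷ʳ v)

Acyclic : ∀ {n} → Graph n → Set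
Acyclic G = ∀ v vs → ¬ IsCycle G v vs

record IsTree {n} (T : Graph n) : Set where
  field
    nonempty  : 0 < n
    connected : Connected T
    acyclic   : Acyclic T

------------------------------------------------------------------------
-- Tree decompositions

nodesOf : ∀ {n N} → (Fin N → Subset n) → Fin n → Subset N
nodesOf X u = tabulate (λ t → lookup (X t) u)

record IsTreeDecomposition {n N} (G : Graph n) (T : Graph N) (X : Fin N → Subset n) : Set where
  field
    isTree            : IsTree T
    covers-vertices   : ∀ u → ∃[ t ] u ∈ X t
    covers-edges      : ∀ u v → Adj G u v → ∃[ t ] (u ∈ X t × v ∈ X t)
    connected-subtree : ∀ u → Connected (T [ nodesOf X u ])

record TreeDecomposition {n} (G : Graph n) : Set where
  field
    nodes               : ℕ
    tree                : Graph nodes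
    bag                 : Fin nodes → Subset n
    isTreeDecomposition : IsTreeDecomposition G tree bag

open TreeDecomposition public

-- Integer-valued, since the graph without vertices has treewidth -1.
width : ∀ {n} {G : Graph n} → TreeDecomposition G → ℤ
width 𝒯 = + maxOver (λ t → ∣ bag 𝒯 t ∣) ℤ.- + 1

IsTreewidth : ∀ {n} → Graph n → ℤ → Set
IsTreewidth G = IsMinimumℤ {A = TreeDecomposition G} width

------------------------------------------------------------------------
-- Ramsey numbers

HasCliqueOrIndependent : ∀ {n} → ℕ → ℕ → Graph n → Set
HasCliqueOrIndependent p q G =
  (∃[ S ] IsClique G S × ∣ S ∣ ≡ p) ⊎ (∃[ S ] IsIndependent G S × ∣ S ∣ ≡ q)

RamseyProperty : ℕ → ℕ → ℕ → Set
RamseyProperty p q N = ∀ {n} (G : Graph n) → N ≤ n → HasCliqueOrIndependent p q G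

IsRamseyNumber : ℕ → ℕ → ℕ → Set
IsRamseyNumber p q N =
  (1 ≤ N × RamseyProperty p q N) × (∀ M → 1 ≤ M → RamseyProperty p q M → N ≤ M)

------------------------------------------------------------------------
-- Existence of the extrema above, which makes the numbers ω, α, R, tw
-- and tree-α defined below functions.  Readers interested only in the
-- definitions may skip to the next section.

least : {P : ℕ → Set} → Unary.Decidable P → ∀ m → P m → ∃[ l ] (P l × (∀ k → P k → l ≤ k))
least P? m pm with P? 0
... | yes p0 = 0 , p0 , λ _ _ → z≤n
least P? zero    pm | no ¬p0 = contradiction pm ¬p0
least {P} P? (suc m) pm | no ¬p0 with least (P? ∘ suc) m pm
... | l , pl , min = suc l , pl , min′
  where
  min′ : ∀ k → P k → suc l ≤ k
  min′ zero    p = contradiction p ¬p0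
  min′ (suc k) p = s≤s (min k p)

greatest : {P : ℕ → Set} → Unary.Decidable P → ∀ n → (∀ k → P k → k ≤ n) → ∃ P →
           ∃[ g ] (P g × (∀ k → P k → k ≤ g))
greatest P? n bnd ex with P? n
... | yes pn = n , pn , bnd
greatest {P} P? zero bnd (k , pk) | no ¬pn =
  contradiction (subst P (ℕ.n≤0⇒n≡0 (bnd k pk)) pk) ¬pn
greatest {P} P? (suc n) bnd ex | no ¬pn = greatest P? n bnd′ ex
  where
  bnd′ : ∀ k → P k → k ≤ n
  bnd′ k pk = s≤s⁻¹ (ℕ.≤∧≢⇒< (bnd k pk) λ { refl → ¬pn pk })

maximum-exists : ∀ {n} {P : Subset n → Set} → Unary.Decidable P → P ⊥ →
                 ∃ (IsMaximum {A = ∃ P} (∣_∣ ∘ proj₁))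
maximum-exists {n} {P} P? p⊥
  with greatest {λ m → ∃[ S ] (P S × ∣ S ∣ ≡ m)} (λ m → anySubset? λ S → P? S ×-dec (∣ S ∣ ℕ.≟ m))
         n (λ { k (S , _ , refl) → ∣p∣≤n S }) (_ , ⊥ , p⊥ , refl)
... | g , (S , pS , eq) , max′ = g , ((S , pS) , eq) , λ { (S , pS) → max′ _ (S , pS , refl) }

≤maxOver : ∀ {n} (f : Fin n → ℕ) i → f i ≤ maxOver f
≤maxOver f i = All.tabulate⁻ (xs≤max 0 (List.tabulate f)) i

maxOver≤ : ∀ {n} (f : Fin n → ℕ) {m} → (∀ i → f i ≤ m) → maxOver f ≤ m
maxOver≤ f h = max≤v⁺ z≤n (All.tabulate⁺ h)

Adj? : ∀ {n} (G : Graph n) → Decidable (Adj G)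
Adj? G u v = adj G u v Bool.≟ true

Adj-sym : ∀ {n} (G : Graph n) {u v} → Adj G u v → Adj G v u
Adj-sym G a = trans (adj-sym G _ _) a

Adj-irrefl : ∀ {n} (G : Graph n) {v} → ¬ Adj G v v
Adj-irrefl G a with trans (sym a) (adj-irrefl G _)
... | ()

isClique? : ∀ {n} (G : Graph n) → Unary.Decidable (IsClique G)
isClique? G S = all? λ u → all? λ v → (u ∈? S) →-dec ((v ∈? S) →-dec (¬? (u ≟ v) →-dec Adj? G u v))

isIndependent? : ∀ {n} (G : Graph n) → Unary.Decidable (IsIndependent G)
isIndependent? G S = all? λ u → all? λ v → (u ∈? S) →-dec ((v ∈? S) →-dec ¬? (Adj? G u v))

clique-⊥ : ∀ {n} (G : Graph n) → IsClique G ⊥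
clique-⊥ G u v u∈ = contradiction u∈ ∉⊥

independent-⊥ : ∀ {n} (G : Graph n) → IsIndependent G ⊥
independent-⊥ G u v u∈ = contradiction u∈ ∉⊥

abstract
  cliqueNumber-exists : ∀ {n} (G : Graph n) → ∃ (IsCliqueNumber G)
  cliqueNumber-exists G = maximum-exists (isClique? G) (clique-⊥ G)

  independenceNumber-exists : ∀ {n} (G : Graph n) → ∃ (IsIndependenceNumber G)
  independenceNumber-exists G = maximum-exists (isIndependent? G) (independent-⊥ G)

-- Exhaustive search over graphs.

anyVec? : {A : Set} → (∀ {P : A → Set} → Unary.Decidable P → Dec (∃ P)) →
          ∀ {n} {P : Vec A n → Set} → Unary.Decidable P → Dec (∃ P)
anyVec? anyA? {zero}  P? = map′ ([] ,_) (λ { ([] , p) → p }) (P? [])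
anyVec? anyA? {suc n} P? =
  map′ (λ { (x , xs , p) → x ∷ xs , p }) (λ { (x ∷ xs , p) → x , xs , p })
       (anyA? λ x → anyVec? anyA? λ xs → P? (x ∷ xs))

Matrix : ℕ → Set
Matrix n = Vec (Subset n) n

entry : ∀ {n} → Matrix n → Fin n → Fin n → Bool
entry M u v = lookup (lookup M u) v

graphAdj : ∀ {n} → (Fin n → Fin n → Bool) → Fin n → Fin n → Bool
graphAdj f u v with u ≟ v
... | yes _ = false
... | no  _ = f u v ∨ f v u

mkGraph : ∀ {n} → (Fin n → Fin n → Bool) → Graph n
mkGraph f = record { adj = graphAdj f ; adj-sym = s ; adj-irrefl = i }
  where
  s : ∀ u v → graphAdj f u v ≡ graphAdj f v u
  s u v with u ≟ v | v ≟ u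
  ... | yes _ | yes _ = refl
  ... | no _  | no _  = Bool.∨-comm (f u v) (f v u)
  ... | yes p | no ¬p = contradiction (sym p) ¬p
  ... | no ¬p | yes p = contradiction (sym p) ¬p
  i : ∀ v → graphAdj f v v ≡ false
  i v with v ≟ v
  ... | yes _ = refl
  ... | no ¬p = contradiction refl ¬p

mkGraph-Adj⁺ : ∀ {n} (f : Fin n → Fin n → Bool) {u v} → u ≢ v → f u v ≡ true → Adj (mkGraph f) u v
mkGraph-Adj⁺ f {u} {v} u≢v e with u ≟ v
... | yes u≡v = contradiction u≡v u≢v
... | no _    = cong (_∨ f v u) e

mkGraph-Adj⁻ : ∀ {n} (f : Fin n → Fin n → Bool) {u v} → Adj (mkGraph f) u v →
               u ≢ v × (f u v ≡ true ⊎ f v u ≡ true)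
mkGraph-Adj⁻ f {u} {v} a with u ≟ v
mkGraph-Adj⁻ f () | yes _
... | no u≢v with f u v
...   | true  = u≢v , inj₁ refl
...   | false = u≢v , inj₂ a

_≗ᵍ_ : ∀ {n} → Graph n → Graph n → Set
G ≗ᵍ H = ∀ u v → adj G u v ≡ adj H u v

matrix : ∀ {n} → Graph n → Matrix n
matrix G = tabulate λ u → tabulate (adj G u)

mkGraph-matrix : ∀ {n} (G : Graph n) → G ≗ᵍ mkGraph (entry (matrix G))
mkGraph-matrix G u v with u ≟ v
... | yes refl = adj-irrefl G u
... | no _ = sym (trans (cong₂ _∨_ (e u v) (trans (e v u) (adj-sym G v u))) (Bool.∨-idem _))
  where
  e : ∀ a b → entry (matrix G) a b ≡ adj G a b
  e a b = trans (cong (λ r → lookup r b) (Vec.lookup∘tabulate _ a)) (Vec.lookup∘tabulate _ b)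

anyGraph? : ∀ {n} {P : Graph n → Set} → (∀ {G H} → G ≗ᵍ H → P G → P H) →
            Unary.Decidable P → Dec (∃ P)
anyGraph? resp P? =
  map′ (λ { (M , p) → _ , p }) (λ { (G , p) → matrix G , resp (mkGraph-matrix G) p })
       (anyVec? anySubset? (λ M → P? (mkGraph (entry M))))

-- Decidability of reachability, by the Floyd–Warshall recursion.

module Reach {n} {R : Fin n → Fin n → Set} (R? : Decidable R) where

  Via : List (Fin n) → Fin n → Fin n → Set
  Via []       x y = x ≡ y ⊎ R x y
  Via (k ∷ ks) x y = Via ks x y ⊎ (Via ks x k × Via ks k y)

  via? : ∀ ks x y → Dec (Via ks x y)
  via? []       x y = (x ≟ y) ⊎-dec R? x y
  via? (k ∷ ks) x y = via? ks x y ⊎-dec (via? ks x k ×-dec via? ks k y)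

  sound : ∀ ks {x y} → Via ks x y → Star R x y
  sound []       (inj₁ refl)    = ε
  sound []       (inj₂ r)       = r ◅ ε
  sound (k ∷ ks) (inj₁ v)       = sound ks v
  sound (k ∷ ks) (inj₂ (v , w)) = sound ks v ◅◅ sound ks w

  base : ∀ ks {x y} → x ≡ y ⊎ R x y → Via ks x y
  base []       b = b
  base (k ∷ ks) b = inj₁ (base ks b)

  compose : ∀ ks {x k y} → k ∈ˡ ks → Via ks x k → Via ks k y → Via ks x y
  compose (k ∷ ks) (here refl) v w = inj₂ ([ id , proj₁ ]′ v , [ id , proj₂ ]′ w)
  compose (_ ∷ ks) (there k∈) (inj₁ v)       (inj₁ w)       = inj₁ (compose ks k∈ v w)
  compose (_ ∷ ks) (there k∈) (inj₁ v)       (inj₂ (w , z)) = inj₂ (compose ks k∈ v w , z)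
  compose (_ ∷ ks) (there k∈) (inj₂ (v , w)) (inj₁ z)       = inj₂ (v , compose ks k∈ w z)
  compose (_ ∷ ks) (there k∈) (inj₂ (v , _)) (inj₂ (_ , z)) = inj₂ (v , z)

  complete : ∀ {x y} → Star R x y → Via (allFin n) x y
  complete ε        = base (allFin n) (inj₁ refl)
  complete (r ◅ rs) = compose (allFin n) (∈-allFin _) (base (allFin n) (inj₂ r)) (complete rs)

  star? : Decidable (Star R)
  star? x y = map′ (sound (allFin n)) complete (via? (allFin n) x y)

connected? : ∀ {n} (G : Graph n) → Dec (Connected G)
connected? G = all? λ u → all? λ v → Reach.star? (Adj? G) u v

-- A graph is acyclic iff each of its edges is a bridge.

Avoiding : ∀ {n} (G : Graph n) (x y : Fin n) → Fin n → Fin n → Set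
Avoiding G x y p q = Adj G p q × ¬ (p ≡ x × q ≡ y) × ¬ (p ≡ y × q ≡ x)

avoiding? : ∀ {n} (G : Graph n) x y → Decidable (Avoiding G x y)
avoiding? G x y p q =
  Adj? G p q ×-dec (¬? ((p ≟ x) ×-dec (q ≟ y)) ×-dec ¬? ((p ≟ y) ×-dec (q ≟ x)))

Bridged : ∀ {n} → Graph n → Set
Bridged G = ∀ x y → Adj G x y → ¬ Star (Avoiding G x y) x y

bridged? : ∀ {n} (G : Graph n) → Dec (Bridged G)
bridged? G = all? λ x → all? λ y → Adj? G x y →-dec ¬? (Reach.star? (avoiding? G x y) x y)

module _ {n} {R : Fin n → Fin n → Set} where

  data EndsAt (y : Fin n) : List (Fin n) → Set where
    end : EndsAt y (y ∷ [])
    _∷_ : ∀ a {b bs} → EndsAt y (b ∷ bs) → EndsAt y (a ∷ b ∷ bs)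

  Path : Fin n → Fin n → Set
  Path x y = ∃[ vs ] (Linked R (x ∷ vs) × Unique (x ∷ vs) × EndsAt y (x ∷ vs))

  suffix : ∀ {x y} z vs → x ∈ˡ (z ∷ vs) → Linked R (z ∷ vs) → Unique (z ∷ vs) → EndsAt y (z ∷ vs) → Path x y
  suffix z vs (here refl) l u e = vs , l , u , e
  suffix z (w ∷ vs) (there x∈) (_ ∷ l) (_ ∷ u) (_ ∷ e) = suffix w vs x∈ l u e

  toPath : ∀ {x y} → Star R x y → Path x y
  toPath ε = [] , [-] , [] ∷ [] , end
  toPath {x} (_◅_ {j = z} r rs) with toPath rs
  ... | vs , l , u , e with Data.List.Membership.DecPropositional._∈?_ _≟_ x (z ∷ vs)
  ... | yes x∈ = suffix z vs x∈ l u e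
  ... | no  x∉ = z ∷ vs , r ∷ l , All.¬Any⇒All¬ _ x∉ ∷ u , x ∷ e

acyclic⇒bridged : ∀ {n} (G : Graph n) → Acyclic G → Bridged G
acyclic⇒bridged G ac x y a w with toPath w
... | [] , _ , _ , end = Adj-irrefl G a
... | _ ∷ [] , r ∷ _ , _ , (_ ∷ end) = proj₁ (proj₂ r) (refl , refl)
... | vs@(_ ∷ _ ∷ _) , l , u , e = ac x vs (s≤s (s≤s z≤n) , u , close (Linked.map proj₁ l) e)
  where
  close : ∀ {xs} → Linked (Adj G) xs → EndsAt {R = Avoiding G x y} y xs → Linked (Adj G) (xs ∷ʳ x)
  close [-]     end     = Adj-sym G a ∷ [-]
  close (r ∷ l) (_ ∷ e) = r ∷ close l e

avoiding-sym : ∀ {n} (G : Graph n) {x y p q} → Avoiding G x y p q → Avoiding G x y q p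
avoiding-sym G (a , h , k) = Adj-sym G a , (λ { (e , f) → k (f , e) }) , (λ { (e , f) → h (f , e) })

bridged⇒acyclic : ∀ {n} (G : Graph n) → Bridged G → Acyclic G
bridged⇒acyclic G br v (a ∷ b ∷ cs) (_ , ((v≢a ∷ v≢b ∷ _) ∷ (a≢ ∷ _)) , va ∷ ab ∷ l) =
  br v a va (Star.reverse (avoiding-sym G) (step ◅ walk b cs l a≢))
  where
  step : Avoiding G v a a b
  step = ab , (λ { (e , _) → v≢a (sym e) }) , (λ { (_ , e) → v≢b (sym e) })
  walk : ∀ b cs → Linked (Adj G) (b ∷ cs ∷ʳ v) → All (a ≢_) (b ∷ cs) → Star (Avoiding G v a) b v
  walk b []       (r ∷ _) (a≢b ∷ _) =
    (r , (λ { (_ , e) → v≢a e }) , (λ { (e , _) → a≢b (sym e) })) ◅ ε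
  walk b (c ∷ cs) (r ∷ l) (a≢b ∷ a≢c ∷ a≢) =
    (r , (λ { (_ , e) → a≢c (sym e) }) , (λ { (e , _) → a≢b (sym e) })) ◅ walk c cs l (a≢c ∷ a≢)
bridged⇒acyclic G br v []       (() , _)
bridged⇒acyclic G br v (_ ∷ []) (s≤s () , _)

isTree? : ∀ {n} (T : Graph n) → Dec (IsTree T)
isTree? {n} T = map′
  (λ { (p , c , b) → record { nonempty = p ; connected = c ; acyclic = bridged⇒acyclic T b } })
  (λ t → IsTree.nonempty t , IsTree.connected t , acyclic⇒bridged T (IsTree.acyclic t))
  ((1 ℕ.≤? n) ×-dec (connected? T ×-dec bridged? T))

-- Connectivity of induced subgraphs in terms of walks of the whole graph.

member-∈ : ∀ {n} (S : Subset n) i → member S i ∈ S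
member-∈ (outside ∷ S) i       = there (member-∈ S i)
member-∈ (inside  ∷ S) zero    = here
member-∈ (inside  ∷ S) (suc i) = there (member-∈ S i)

index : ∀ {n} {S : Subset n} {v} → v ∈ S → Fin ∣ S ∣
index {S = inside  ∷ S} here      = zero
index {S = inside  ∷ S} (there p) = suc (index p)
index {S = outside ∷ S} (there p) = index p

member-index : ∀ {n} {S : Subset n} {v} (p : v ∈ S) → member S (index p) ≡ v
member-index {S = inside  ∷ S} here      = refl
member-index {S = inside  ∷ S} (there p) = cong suc (member-index p)
member-index {S = outside ∷ S} (there p) = cong suc (member-index p)

index-member : ∀ {n} (S : Subset n) i → index (member-∈ S i) ≡ i
index-member (outside ∷ S) i       = index-member S i
index-member (inside  ∷ S) zero    = refl
index-member (inside  ∷ S) (suc i) = cong suc (index-member S i)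

index-irrelevant : ∀ {n} {S : Subset n} {v} (p q : v ∈ S) → index p ≡ index q
index-irrelevant {S = inside  ∷ S} here      here      = refl
index-irrelevant {S = inside  ∷ S} (there p) (there q) = cong suc (index-irrelevant p q)
index-irrelevant {S = outside ∷ S} (there p) (there q) = index-irrelevant p q

Within : ∀ {n} → Graph n → Subset n → Fin n → Fin n → Set
Within G S a b = Adj G a b × a ∈ S × b ∈ S

module _ {n} (G : Graph n) (S : Subset n) where

  connected⇒walks : Connected (G [ S ]) → ∀ {a b} → a ∈ S → b ∈ S → Star (Within G S) a b
  connected⇒walks c p q = subst₂ (Star (Within G S)) (member-index p) (member-index q)
    (Star.gmap (member S) (λ r → r , member-∈ S _ , member-∈ S _) (c (index p) (index q)))

  walks⇒connected : (∀ {a b} → a ∈ S → b ∈ S → Star (Within G S) a b) → Connected (G [ S ])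
  walks⇒connected h i j = subst₂ (Star (Adj (G [ S ]))) (index-member S i) (index-member S j)
    (restrict (member-∈ S i) (member-∈ S j) (h (member-∈ S i) (member-∈ S j)))
    where
    restrict : ∀ {a b} (p : a ∈ S) (q : b ∈ S) → Star (Within G S) a b →
               Star (Adj (G [ S ])) (index p) (index q)
    restrict p q ε = subst (Star _ (index p)) (index-irrelevant p q) ε
    restrict p q ((r , _ , c∈) ◅ rs) =
      subst₂ (Adj G) (sym (member-index p)) (sym (member-index c∈)) r ◅ restrict c∈ q rs

∈-nodesOf⁺ : ∀ {n N} (X : Fin N → Subset n) {u t} → u ∈ X t → t ∈ nodesOf X u
∈-nodesOf⁺ X {u} {t} p = Vec.lookup⇒[]= t _ (trans (Vec.lookup∘tabulate _ t) (Vec.[]=⇒lookup p))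

∈-nodesOf⁻ : ∀ {n N} (X : Fin N → Subset n) {u t} → t ∈ nodesOf X u → u ∈ X t
∈-nodesOf⁻ X {u} {t} p = Vec.lookup⇒[]= u _ (trans (sym (Vec.lookup∘tabulate _ t)) (Vec.[]=⇒lookup p))

-- Decidability of being a tree decomposition with a given tree and bags.

isTreeDecomposition? : ∀ {n N} (G : Graph n) (T : Graph N) X → Dec (IsTreeDecomposition G T X)
isTreeDecomposition? G T X = map′
  (λ { (a , b , c , d) → record
         { isTree = a ; covers-vertices = b ; covers-edges = c ; connected-subtree = d } })
  (λ d → let open IsTreeDecomposition d in isTree , covers-vertices , covers-edges , connected-subtree)
  (isTree? T ×-dec ((all? λ u → any? λ t → u ∈? X t) ×-dec
    ((all? λ u → all? λ v → Adj? G u v →-dec any? λ t → (u ∈? X t) ×-dec (v ∈? X t)) ×-dec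
     all? λ u → connected? (T [ nodesOf X u ]))))

connected-resp : ∀ {n} {G H : Graph n} → G ≗ᵍ H → Connected G → Connected H
connected-resp e c u v = Star.map (λ {x} {y} a → trans (sym (e x y)) a) (c u v)

isTreeDecomposition-resp : ∀ {n N} {G : Graph n} {T T′ : Graph N} {X X′} → T ≗ᵍ T′ →
  (∀ t → X t ≡ X′ t) → IsTreeDecomposition G T X → IsTreeDecomposition G T′ X′
isTreeDecomposition-resp {T = T} {T′} {X} {X′} e f d = record
  { isTree = record
    { nonempty  = IsTree.nonempty isTree
    ; connected = connected-resp {G = T} {T′} e (IsTree.connected isTree)
    ; acyclic   = λ { v vs (l , u , k) → IsTree.acyclic isTree v vs
                        (l , u , Linked.map (λ {x} {y} a → trans (e x y) a) k) }
    }
  ; covers-vertices = λ u → let (t , p) = covers-vertices u in t , subst (u ∈_) (f t) p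
  ; covers-edges = λ u v a → let (t , p , q) = covers-edges u v a in
      t , subst (u ∈_) (f t) p , subst (v ∈_) (f t) q
  ; connected-subtree = λ u → connected-resp {G = T [ nodesOf X′ u ]} {T′ [ nodesOf X′ u ]}
      (λ _ _ → e _ _)
      (subst (λ S → Connected (T [ S ])) (Vec.tabulate-cong λ t → cong (λ Y → lookup Y u) (f t))
             (connected-subtree u))
  }
  where open IsTreeDecomposition d

-- Contracting an edge s t of the tree with X s ⊆ X t.

does-true : {P : Set} (d : Dec P) → Dec.does d ≡ true → P
does-true (yes p) _ = p

module Contract {n N} {G : Graph n} {T : Graph (suc N)} {X : Fin (suc N) → Subset n}
  (d : IsTreeDecomposition G T X) (s t : Fin (suc N)) (st : Adj T s t) (Xs⊆Xt : X s ⊆ X t) where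

  open IsTreeDecomposition d

  s≢t : s ≢ t
  s≢t refl = Adj-irrefl T st

  φ : Fin (suc N) → Fin N
  φ x with s ≟ x
  ... | yes _  = punchOut s≢t
  ... | no s≢x = punchOut s≢x

  φ-punchIn : ∀ a → φ (punchIn s a) ≡ a
  φ-punchIn a with s ≟ punchIn s a
  ... | yes e = contradiction (sym e) (punchInᵢ≢i s a)
  ... | no ne = trans (punchOut-cong s refl) (punchOut-punchIn s)

  Y : Fin N → Subset n
  Y = X ∘ punchIn s

  X⊆Y : ∀ x → X x ⊆ Y (φ x)
  X⊆Y x {u} p with s ≟ x
  ... | yes refl = subst (λ z → u ∈ X z) (sym (punchIn-punchOut s≢t)) (Xs⊆Xt p)
  ... | no s≢x   = subst (λ z → u ∈ X z) (sym (punchIn-punchOut s≢x)) p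

  φ-fibre : ∀ x y → φ x ≡ φ y → x ≡ y ⊎ Adj T x y
  φ-fibre x y e with s ≟ x | s ≟ y
  ... | yes refl | yes refl = inj₁ refl
  ... | yes refl | no s≢y   =
    inj₂ (subst (Adj T s) (trans (sym (punchIn-punchOut s≢t)) (trans (cong (punchIn s) e) (punchIn-punchOut s≢y))) st)
  ... | no s≢x   | yes refl =
    inj₂ (Adj-sym T (subst (Adj T s) (trans (sym (punchIn-punchOut s≢t)) (trans (cong (punchIn s) (sym e)) (punchIn-punchOut s≢x))) st))
  ... | no s≢x   | no s≢y   =
    inj₁ (trans (sym (punchIn-punchOut s≢x)) (trans (cong (punchIn s) e) (punchIn-punchOut s≢y)))

  Lift : Fin N → Fin N → Set
  Lift a b = ∃[ x ] ∃[ y ] (φ x ≡ a × φ y ≡ b × Adj T x y)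

  lift? : ∀ a b → Dec (Lift a b)
  lift? a b = any? λ x → any? λ y → (φ x ≟ a) ×-dec ((φ y ≟ b) ×-dec Adj? T x y)

  T/ : Graph N
  T/ = mkGraph λ a b → Dec.does (lift? a b)

  lift : ∀ {a b} → Adj T/ a b → a ≢ b × Lift a b
  lift {a} {b} h with mkGraph-Adj⁻ (λ a b → Dec.does (lift? a b)) h
  ... | a≢b , inj₁ e = a≢b , does-true (lift? a b) e
  ... | a≢b , inj₂ e with does-true (lift? b a) e
  ...   | x , y , p , q , r = a≢b , y , x , q , p , Adj-sym T r

  push : ∀ {x y} → Adj T x y → φ x ≡ φ y ⊎ Adj T/ (φ x) (φ y)
  push {x} {y} a = decide (φ x ≟ φ y)
    where
    decide : Dec (φ x ≡ φ y) → φ x ≡ φ y ⊎ Adj T/ (φ x) (φ y)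
    decide (yes e) = inj₁ e
    decide (no ne) = inj₂ (mkGraph-Adj⁺ (λ a b → Dec.does (lift? a b)) ne
                            (dec-true (lift? (φ x) (φ y)) (x , y , refl , refl , a)))

  pushWalk : ∀ {x y} → Star (Adj T) x y → Star (Adj T/) (φ x) (φ y)
  pushWalk ε = ε
  pushWalk {y = y} (r ◅ rs) with push r
  ... | inj₁ e = subst (λ a → Star (Adj T/) a (φ y)) (sym e) (pushWalk rs)
  ... | inj₂ a = a ◅ pushWalk rs

  pushWithin : ∀ {u x y} → Star (Within T (nodesOf X u)) x y → Star (Within T/ (nodesOf Y u)) (φ x) (φ y)
  pushWithin ε = ε
  pushWithin {y = y} ((r , p , q) ◅ rs) with push r
  ... | inj₁ e = subst (λ a → Star (Within T/ _) a (φ y)) (sym e) (pushWithin rs)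
  ... | inj₂ a = (a , move p , move q) ◅ pushWithin rs
    where
    move : ∀ {u z} → z ∈ nodesOf X u → φ z ∈ nodesOf Y u
    move p = ∈-nodesOf⁺ Y (X⊆Y _ (∈-nodesOf⁻ X p))

  bridged/ : Bridged T/
  bridged/ a b ab w with lift ab
  ... | a≢b , x , y , φx , φy , xy =
    acyclic⇒bridged T (IsTree.acyclic isTree) x y xy (liftWalk φx φy w)
    where
    fibre : ∀ x′ y′ → φ x′ ≡ φ y′ → Star (Avoiding T x y) x′ y′
    fibre x′ y′ e with φ-fibre x′ y′ e
    ... | inj₁ refl = ε
    ... | inj₂ r    = (r , (λ { (refl , refl) → a≢b (trans (sym φx) (trans e φy)) })
                         , (λ { (refl , refl) → a≢b (trans (sym φx) (trans (sym e) φy)) })) ◅ ε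
    liftWalk : ∀ {c d x′ y′} → φ x′ ≡ c → φ y′ ≡ d → Star (Avoiding T/ a b) c d → Star (Avoiding T x y) x′ y′
    liftWalk e f ε = fibre _ _ (trans e (sym f))
    liftWalk e f ((r , h , k) ◅ rs) with lift r
    ... | _ , p , q , φp , φq , pq =
      fibre _ p (trans e (sym φp)) ◅◅
      (pq , (λ { (refl , refl) → h (trans (sym φp) φx , trans (sym φq) φy) })
          , (λ { (refl , refl) → k (trans (sym φp) φy , trans (sym φq) φx) })) ◅
      liftWalk φq f rs

  nonempty/ : 0 < N
  nonempty/ = ℕ.≤-trans (s≤s z≤n) (toℕ<n (φ s))

  contracted : IsTreeDecomposition G T/ Y
  contracted = record
    { isTree = record
      { nonempty  = nonempty/
      ; connected = λ a b → subst₂ (Star (Adj T/)) (φ-punchIn a) (φ-punchIn b)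
                              (pushWalk (IsTree.connected isTree (punchIn s a) (punchIn s b)))
      ; acyclic   = bridged⇒acyclic T/ bridged/
      }
    ; covers-vertices = λ u → let (x , p) = covers-vertices u in φ x , X⊆Y x p
    ; covers-edges = λ u v a → let (x , p , q) = covers-edges u v a in φ x , X⊆Y x p , X⊆Y x q
    ; connected-subtree = λ u → walks⇒connected T/ (nodesOf Y u) λ {a} {b} p q →
        subst₂ (Star (Within T/ (nodesOf Y u))) (φ-punchIn a) (φ-punchIn b)
          (pushWithin (connected⇒walks T (nodesOf X u) (connected-subtree u)
            (∈-nodesOf⁺ X (∈-nodesOf⁻ Y p)) (∈-nodesOf⁺ X (∈-nodesOf⁻ Y q))))
    }

-- If two nodes have the same bag, then some tree edge can be contracted.

module _ {n N} {G : Graph n} {T : Graph N} {X : Fin N → Subset n}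
  (d : IsTreeDecomposition G T X) {s r : Fin N} (s≢r : s ≢ r) (Xs≡Xr : X s ≡ X r) where

  open IsTreeDecomposition d

  Missing : Fin N → Fin N → Set
  Missing p q = Adj T p q × p ≢ s × q ≢ s

  missing-source : ∀ {x} → Star Missing x r → x ≢ s
  missing-source ε               refl = s≢r refl
  missing-source ((_ , h , _) ◅ _) e  = h e

  lastDeparture : ∀ {x} → Star (Adj T) x r → Star Missing x r ⊎ ∃[ t ] (Adj T s t × Star Missing t r)
  lastDeparture ε = inj₁ ε
  lastDeparture {x} (a ◅ w) with lastDeparture w
  ... | inj₂ l = inj₂ l
  ... | inj₁ m with x ≟ s
  ...   | yes refl = inj₂ (_ , a , m)
  ...   | no x≢s   = inj₁ ((a , x≢s , missing-source m) ◅ m)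

  contractible : ∃[ t ] (Adj T s t × X s ⊆ X t)
  contractible with lastDeparture (IsTree.connected isTree s r)
  ... | inj₁ m = contradiction refl (missing-source m)
  ... | inj₂ (t , st , m) = t , st , sub
    where
    sub : X s ⊆ X t
    sub {u} u∈s with u ∈? X t
    ... | yes p = p
    ... | no ¬p = ⊥-elim (acyclic⇒bridged T (IsTree.acyclic isTree) s t st (there-walk ◅◅ back-walk))
      where
      there-walk : Star (Avoiding T s t) s r
      there-walk = Star.map
        (λ { (a , p , q) → a , (λ { (_ , refl) → ¬p (∈-nodesOf⁻ X q) })
                             , (λ { (refl , _) → ¬p (∈-nodesOf⁻ X p) }) })
        (connected⇒walks T (nodesOf X u) (connected-subtree u)
          (∈-nodesOf⁺ X u∈s) (∈-nodesOf⁺ X (subst (u ∈_) Xs≡Xr u∈s)))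
      back-walk : Star (Avoiding T s t) r t
      back-walk = Star.reverse (avoiding-sym T) (Star.map
        (λ { (a , p , q) → a , (λ { (refl , _) → p refl }) , (λ { (_ , refl) → q refl }) }) m)

-- Hence it suffices to look for tree decompositions with at most 2 ^ n nodes.

code : ∀ {n} → Subset n → Fin (2 ^ n)
code S = funToFin (Inverse.from 2↔Bool ∘ lookup S)

code-injective : ∀ {n} {S S′ : Subset n} → code S ≡ code S′ → S ≡ S′
code-injective {S = S} {S′} e =
  trans (sym (Vec.tabulate∘lookup S)) (trans (Vec.tabulate-cong same) (Vec.tabulate∘lookup S′))
  where
  same : ∀ i → lookup S i ≡ lookup S′ i
  same i = trans (sym (Inverse.strictlyInverseˡ 2↔Bool _)) (trans
    (cong (Inverse.to 2↔Bool) (trans (sym (finToFun-funToFin _ i))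
      (trans (cong (λ c → finToFun c i) e) (finToFun-funToFin _ i))))
    (Inverse.strictlyInverseˡ 2↔Bool _))

module _ {n} (G : Graph n) (Q : Subset n → Set) (Q? : Unary.Decidable Q) where

  HasDecomposition : ℕ → Set
  HasDecomposition N = ∃[ T ] ∃[ X ] (IsTreeDecomposition {N = N} G T X × (∀ t → Q (X t)))

  shrink : ∀ N → HasDecomposition N → ∃[ M ] (M < suc (2 ^ n) × HasDecomposition M)
  shrink N h with N ℕ.≤? 2 ^ n
  ... | yes le = N , s≤s le , h
  shrink zero    h | no gt = contradiction z≤n gt
  shrink (suc N) (T , X , d , q) | no gt with pigeonhole (ℕ.≰⇒> gt) (code ∘ X)
  ... | s , r , s<r , e with contractible d (<⇒≢ s<r) (code-injective e)
  ... | t , st , sub = shrink N (_ , _ , Contract.contracted d s t st sub , q ∘ punchIn s)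

  hasDecomposition? : ∀ N → Dec (HasDecomposition N)
  hasDecomposition? N = anyGraph?
    (λ { {T} {T′} e (X , d , q) → X , isTreeDecomposition-resp {T = T} {T′} e (λ _ → refl) d , q })
    λ T → map′ (λ { (X , p) → lookup X , p })
               (λ { (X , d , q) → tabulate X
                  , isTreeDecomposition-resp {T = T} {T} (λ _ _ → refl) (λ t → sym (Vec.lookup∘tabulate X t)) d
                  , λ t → subst Q (sym (Vec.lookup∘tabulate X t)) (q t) })
               (anyVec? anySubset? λ X → isTreeDecomposition? G T (lookup X) ×-dec all? λ t → Q? (lookup X t))

  decomposition? : Dec (∃[ 𝒯 ] (∀ t → Q (bag {G = G} 𝒯 t)))
  decomposition? = map′
    (λ { (i , T , X , d , q) → record { isTreeDecomposition = d } , q })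
    (λ { (𝒯 , q) → let (M , M< , h) = shrink _ (_ , _ , isTreeDecomposition 𝒯 , q) in
         fromℕ< M< , subst HasDecomposition (sym (toℕ-fromℕ< M<)) h })
    (any? {n = suc (2 ^ n)} λ i → hasDecomposition? (toℕ i))

trivialDecomposition : ∀ {n} (G : Graph n) → TreeDecomposition G
trivialDecomposition {n} G = record
  { nodes = 1 ; tree = K₁ ; bag = λ _ → ⊤
  ; isTreeDecomposition = record
    { isTree = record
      { nonempty  = s≤s z≤n
      ; connected = λ { zero zero → ε }
      ; acyclic   = λ { zero (zero ∷ _) (_ , ((0≢0 ∷ _) ∷ _) , _) → 0≢0 refl }
      }
    ; covers-vertices = λ _ → zero , ∈⊤
    ; covers-edges = λ _ _ _ → zero , ∈⊤ , ∈⊤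
    ; connected-subtree = λ u → walks⇒connected K₁ (nodesOf (λ _ → ⊤) u) λ { {zero} {zero} _ _ → ε }
    }
  }
  where
  K₁ : Graph 1
  K₁ = record { adj = λ _ _ → false ; adj-sym = λ _ _ → refl ; adj-irrefl = λ _ → refl }

minimum-exists : ∀ {n} (G : Graph n) (μ : Subset n → ℕ) →
                 ∃ (IsMinimum {A = TreeDecomposition G} (λ 𝒯 → maxOver (λ t → μ (bag 𝒯 t))))
minimum-exists G μ = attained
  (least {Bounded} (λ m → decomposition? G (λ S → μ S ≤ m) (λ S → μ S ℕ.≤? m)) _
    (trivialDecomposition G , ≤maxOver (λ t → μ (bag (trivialDecomposition G) t))))
  where
  Bounded : ℕ → Set
  Bounded m = ∃[ 𝒯 ] (∀ t → μ (bag {G = G} 𝒯 t) ≤ m)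
  attained : ∃[ l ] (Bounded l × (∀ k → Bounded k → l ≤ k)) → _
  attained (m , (𝒯 , h) , min) = m
    , (𝒯 , ℕ.≤-antisym (maxOver≤ _ h) (min _ (𝒯 , ≤maxOver (λ t → μ (bag 𝒯 t)))))
    , λ 𝒯′ → min _ (𝒯′ , ≤maxOver (λ t → μ (bag 𝒯′ t)))

treewidth-from-minimum : ∀ {n} {G : Graph n} →
  ∃ (IsMinimum {A = TreeDecomposition G} (λ 𝒯 → maxOver (λ t → ∣ bag 𝒯 t ∣))) → ∃ (IsTreewidth G)
treewidth-from-minimum (m , (𝒯 , e) , min) = + m ℤ.- + 1 , (𝒯 , cong (λ z → + z ℤ.- + 1) e)
  , λ 𝒯′ → ℤ.+-monoˡ-≤ (ℤ.- + 1) (ℤ.+≤+ (min 𝒯′))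

abstract
  treewidth-exists : ∀ {n} (G : Graph n) → ∃ (IsTreewidth G)
  treewidth-exists G = treewidth-from-minimum (minimum-exists G ∣_∣)

-- Ramsey's theorem, with a crude bound.

∣p∩q∣+∣p∩∁q∣≡∣p∣ : ∀ {n} (p q : Subset n) → ∣ p ∩ q ∣ + ∣ p ∩ ∁ q ∣ ≡ ∣ p ∣
∣p∩q∣+∣p∩∁q∣≡∣p∣ []            []            = refl
∣p∩q∣+∣p∩∁q∣≡∣p∣ (outside ∷ p) (_ ∷ q)       = ∣p∩q∣+∣p∩∁q∣≡∣p∣ p q
∣p∩q∣+∣p∩∁q∣≡∣p∣ (inside ∷ p)  (inside ∷ q)  = cong suc (∣p∩q∣+∣p∩∁q∣≡∣p∣ p q)
∣p∩q∣+∣p∩∁q∣≡∣p∣ (inside ∷ p)  (outside ∷ q) =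
  trans (ℕ.+-suc _ _) (cong suc (∣p∩q∣+∣p∩∁q∣≡∣p∣ p q))

∣⁅x⁆∪p∣≡1+∣p∣ : ∀ {n} {x : Fin n} (p : Subset n) → x ∉ p → ∣ ⁅ x ⁆ ∪ p ∣ ≡ suc ∣ p ∣
∣⁅x⁆∪p∣≡1+∣p∣ {x = zero}  (inside ∷ p)  x∉ = contradiction here x∉
∣⁅x⁆∪p∣≡1+∣p∣ {x = zero}  (outside ∷ p) x∉ = cong (suc ∘ ∣_∣) (∪-identityˡ p)
∣⁅x⁆∪p∣≡1+∣p∣ {x = suc x} (inside ∷ p)  x∉ = cong suc (∣⁅x⁆∪p∣≡1+∣p∣ p (x∉ ∘ there))
∣⁅x⁆∪p∣≡1+∣p∣ {x = suc x} (outside ∷ p) x∉ = ∣⁅x⁆∪p∣≡1+∣p∣ p (x∉ ∘ there)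

∣p∣≡1+∣p-x∣ : ∀ {n} {x : Fin n} (p : Subset n) → x ∈ p → ∣ p ∣ ≡ suc ∣ p - x ∣
∣p∣≡1+∣p-x∣ (inside ∷ p)  here      = cong (suc ∘ ∣_∣) (sym (p─⊥≡p p))
∣p∣≡1+∣p-x∣ (inside ∷ p)  (there i) = cong suc (∣p∣≡1+∣p-x∣ p i)
∣p∣≡1+∣p-x∣ (outside ∷ p) (there i) = ∣p∣≡1+∣p-x∣ p i

x∉p-x : ∀ {n} {x : Fin n} (p : Subset n) → x ∉ p - x
x∉p-x {x = suc x} (_ ∷ p) (there i) = x∉p-x p i

0<∣p∣⇒nonempty : ∀ {n} (p : Subset n) → 0 < ∣ p ∣ → Nonempty p
0<∣p∣⇒nonempty (inside ∷ p)  _ = zero , here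
0<∣p∣⇒nonempty (outside ∷ p) h with 0<∣p∣⇒nonempty p h
... | x , x∈ = suc x , there x∈

ramseyBound : ℕ → ℕ → ℕ
ramseyBound zero    q       = 0
ramseyBound (suc p) zero    = 0
ramseyBound (suc p) (suc q) = suc (ramseyBound p (suc q) + ramseyBound (suc p) q)

module _ {n} (G : Graph n) where

  neighbours : Fin n → Subset n
  neighbours v = tabulate (adj G v)

  ∈-neighbours⁻ : ∀ {v w} → w ∈ neighbours v → Adj G v w
  ∈-neighbours⁻ {v} {w} p = trans (sym (Vec.lookup∘tabulate (adj G v) w)) (Vec.[]=⇒lookup p)

  ∈-neighbours⁺ : ∀ {v w} → Adj G v w → w ∈ neighbours v
  ∈-neighbours⁺ {v} {w} a = Vec.lookup⇒[]= w _ (trans (Vec.lookup∘tabulate (adj G v) w) a)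

  clique-insert : ∀ {v C} → IsClique G C → C ⊆ neighbours v → IsClique G (⁅ v ⁆ ∪ C)
  clique-insert {v} {C} c s a b a∈ b∈ a≢b with x∈p∪q⁻ ⁅ v ⁆ C a∈ | x∈p∪q⁻ ⁅ v ⁆ C b∈
  ... | inj₂ p | inj₂ q = c a b p q a≢b
  ... | inj₁ p | inj₂ q with x∈⁅y⁆⇒x≡y v p
  ...   | refl = ∈-neighbours⁻ (s q)
  clique-insert {v} {C} c s a b a∈ b∈ a≢b | inj₂ p | inj₁ q with x∈⁅y⁆⇒x≡y v q
  ...   | refl = Adj-sym G (∈-neighbours⁻ (s p))
  clique-insert {v} {C} c s a b a∈ b∈ a≢b | inj₁ p | inj₁ q =
    contradiction (trans (x∈⁅y⁆⇒x≡y v p) (sym (x∈⁅y⁆⇒x≡y v q))) a≢b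

  independent-insert : ∀ {v C} → IsIndependent G C → C ⊆ ∁ (neighbours v) → IsIndependent G (⁅ v ⁆ ∪ C)
  independent-insert {v} {C} c s a b a∈ b∈ ab with x∈p∪q⁻ ⁅ v ⁆ C a∈ | x∈p∪q⁻ ⁅ v ⁆ C b∈
  ... | inj₂ p | inj₂ q = c a b p q ab
  ... | inj₁ p | inj₂ q with x∈⁅y⁆⇒x≡y v p
  ...   | refl = x∈∁p⇒x∉p (s q) (∈-neighbours⁺ ab)
  independent-insert {v} {C} c s a b a∈ b∈ ab | inj₂ p | inj₁ q with x∈⁅y⁆⇒x≡y v q
  ...   | refl = x∈∁p⇒x∉p (s p) (∈-neighbours⁺ (Adj-sym G ab))
  independent-insert {v} {C} c s a b a∈ b∈ ab | inj₁ p | inj₁ q with x∈⁅y⁆⇒x≡y v p | x∈⁅y⁆⇒x≡y v q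
  ...   | refl | refl = Adj-irrefl G ab

  ramsey-subset : ∀ p q S → ramseyBound p q ≤ ∣ S ∣ →
    (∃[ C ] (C ⊆ S × IsClique G C × ∣ C ∣ ≡ p)) ⊎ (∃[ C ] (C ⊆ S × IsIndependent G C × ∣ C ∣ ≡ q))
  ramsey-subset zero    q       S _ = inj₁ (⊥ , (λ x∈ → contradiction x∈ ∉⊥) , clique-⊥ G , ∣⊥∣≡0 n)
  ramsey-subset (suc p) zero    S _ = inj₂ (⊥ , (λ x∈ → contradiction x∈ ∉⊥) , independent-⊥ G , ∣⊥∣≡0 n)
  ramsey-subset (suc p) (suc q) S h with 0<∣p∣⇒nonempty S (ℕ.≤-trans (s≤s z≤n) h)
  ... | v , v∈S = split (ℕ.≤-total r₁ (∣ A ∣))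
    where
    r₁ = ramseyBound p (suc q)
    r₂ = ramseyBound (suc p) q
    S′ = S - v
    A = S′ ∩ neighbours v
    B = S′ ∩ ∁ (neighbours v)

    S′⊆S : S′ ⊆ S
    S′⊆S = p─q⊆p S ⁅ v ⁆

    v∉S′ : v ∉ S′
    v∉S′ = x∉p-x S

    sizes : r₁ + r₂ ≤ ∣ A ∣ + ∣ B ∣
    sizes = ℕ.≤-trans (s≤s⁻¹ (subst (suc (r₁ + r₂) ≤_) (∣p∣≡1+∣p-x∣ S v∈S) h))
                      (ℕ.≤-reflexive (sym (∣p∩q∣+∣p∩∁q∣≡∣p∣ S′ (neighbours v))))

    A⊆S′ : A ⊆ S′
    A⊆S′ i = proj₁ (x∈p∩q⁻ S′ _ i)
    B⊆S′ : B ⊆ S′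
    B⊆S′ i = proj₁ (x∈p∩q⁻ S′ _ i)

    insert-⊆ : ∀ {C} → C ⊆ S′ → ⁅ v ⁆ ∪ C ⊆ S
    insert-⊆ {C} s i with x∈p∪q⁻ ⁅ v ⁆ C i
    ... | inj₁ j = subst (_∈ S) (sym (x∈⁅y⁆⇒x≡y v j)) v∈S
    ... | inj₂ j = S′⊆S (s j)

    Goal = (∃[ C ] (C ⊆ S × IsClique G C × ∣ C ∣ ≡ suc p)) ⊎
           (∃[ C ] (C ⊆ S × IsIndependent G C × ∣ C ∣ ≡ suc q))

    inA : r₁ ≤ ∣ A ∣ → Goal
    inA le with ramsey-subset p (suc q) A le
    ... | inj₂ (C , s , i , e) = inj₂ (C , (λ x → S′⊆S (A⊆S′ (s x))) , i , e)
    ... | inj₁ (C , s , c , e) = inj₁ (⁅ v ⁆ ∪ C , insert-⊆ (λ x → A⊆S′ (s x))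
          , clique-insert c (λ x → proj₂ (x∈p∩q⁻ S′ _ (s x)))
          , trans (∣⁅x⁆∪p∣≡1+∣p∣ C (λ i → v∉S′ (A⊆S′ (s i)))) (cong suc e))

    inB : r₂ ≤ ∣ B ∣ → Goal
    inB le with ramsey-subset (suc p) q B le
    ... | inj₁ (C , s , i , e) = inj₁ (C , (λ x → S′⊆S (B⊆S′ (s x))) , i , e)
    ... | inj₂ (C , s , c , e) = inj₂ (⁅ v ⁆ ∪ C , insert-⊆ (λ x → B⊆S′ (s x))
          , independent-insert c (λ x → proj₂ (x∈p∩q⁻ S′ _ (s x)))
          , trans (∣⁅x⁆∪p∣≡1+∣p∣ C (λ i → v∉S′ (B⊆S′ (s i)))) (cong suc e))

    split : r₁ ≤ ∣ A ∣ ⊎ ∣ A ∣ ≤ r₁ → Goal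
    split (inj₁ le) = inA le
    split (inj₂ ge) = inB (ℕ.+-cancelˡ-≤ r₁ _ _ (ℕ.≤-trans sizes (ℕ.+-monoˡ-≤ ∣ B ∣ ge)))

ramsey : ∀ p q → RamseyProperty p q (ramseyBound p q)
ramsey p q {n} G h with ramsey-subset G p q ⊤ (subst (ramseyBound p q ≤_) (sym (∣⊤∣≡n n)) h)
... | inj₁ (C , _ , c , e) = inj₁ (C , c , e)
... | inj₂ (C , _ , c , e) = inj₂ (C , c , e)

hasCliqueOrIndependent? : ∀ {n} p q (G : Graph n) → Dec (HasCliqueOrIndependent p q G)
hasCliqueOrIndependent? p q G =
  (anySubset? λ S → isClique? G S ×-dec (∣ S ∣ ℕ.≟ p)) ⊎-dec
  (anySubset? λ S → isIndependent? G S ×-dec (∣ S ∣ ℕ.≟ q))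

hasCliqueOrIndependent-resp : ∀ {n p q} {G H : Graph n} → G ≗ᵍ H →
  HasCliqueOrIndependent p q G → HasCliqueOrIndependent p q H
hasCliqueOrIndependent-resp eq (inj₁ (S , c , e)) =
  inj₁ (S , (λ u v p q r → trans (sym (eq u v)) (c u v p q r)) , e)
hasCliqueOrIndependent-resp eq (inj₂ (S , c , e)) =
  inj₂ (S , (λ u v p q r → c u v p q (trans (eq u v) r)) , e)

allGraphs? : ∀ n p q → Dec (∀ (G : Graph n) → HasCliqueOrIndependent p q G)
allGraphs? n p q with anyGraph? {n} {λ G → ¬ HasCliqueOrIndependent p q G}
                        (λ {G} {H} e h k → h (hasCliqueOrIndependent-resp {G = H} {G} (λ u v → sym (e u v)) k))
                        (λ G → ¬? (hasCliqueOrIndependent? p q G))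
... | yes (G , h) = no λ k → h (k G)
... | no  none    = yes λ G → decidable-stable (hasCliqueOrIndependent? p q G) λ h → none (G , h)

ramseyProperty? : ∀ p q N → Dec (RamseyProperty p q N)
ramseyProperty? p q N = map′ to (λ h {n} _ le G → h G le)
  (ℕ.allUpTo? (λ n → (N ℕ.≤? n) →-dec allGraphs? n p q) (ramseyBound p q))
  where
  to : (∀ {n} → n < ramseyBound p q → N ≤ n → (G : Graph n) → HasCliqueOrIndependent p q G) → RamseyProperty p q N
  to h {n} G le with n ℕ.<? ramseyBound p q
  ... | yes lt = h lt le G
  ... | no ge  = ramsey p q G (ℕ.≮⇒≥ ge)

abstract
  ramseyNumber-exists : ∀ p q → ∃ (IsRamseyNumber p q)
  ramseyNumber-exists p q
    with least {λ N → 1 ≤ N × RamseyProperty p q N} (λ N → (1 ℕ.≤? N) ×-dec ramseyProperty? p q N)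
           (suc (ramseyBound p q)) (s≤s z≤n , λ G le → ramsey p q G (ℕ.≤-trans (ℕ.n≤1+n _) le))
  ... | N , pN , min = N , pN , λ M le h → min M (le , h)

------------------------------------------------------------------------
-- The numerical invariants

ω : ∀ {n} → Graph n → ℕ
ω G = proj₁ (cliqueNumber-exists G)

α : ∀ {n} → Graph n → ℕ
α G = proj₁ (independenceNumber-exists G)

tw : ∀ {n} → Graph n → ℤ
tw G = proj₁ (treewidth-exists G)

-- The independence number of a tree decomposition.
αᵗ : ∀ {n} {G : Graph n} → TreeDecomposition G → ℕ
αᵗ {G = G} 𝒯 = maxOver (λ t → α (G [ bag 𝒯 t ]))

IsTreeIndependenceNumber : ∀ {n} → Graph n → ℕ → Set
IsTreeIndependenceNumber G = IsMinimum {A = TreeDecomposition G} αᵗ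

abstract
  treeIndependenceNumber-exists : ∀ {n} (G : Graph n) → ∃ (IsTreeIndependenceNumber G)
  treeIndependenceNumber-exists G = minimum-exists G (λ X → α (G [ X ]))

tree-α : ∀ {n} → Graph n → ℕ
tree-α G = proj₁ (treeIndependenceNumber-exists G)

-- Meaningful for p, q ≥ 1; R 0 q and R p 0 equal 1.
R : ℕ → ℕ → ℕ
R p q = proj₁ (ramseyNumber-exists p q)

------------------------------------------------------------------------
-- (tw,ω)-boundedness

GraphClass : Set₁
GraphClass = ∀ {n} → Graph n → Set

-- Integer-valued, like tw.
IsBindingFunction : GraphClass → (ℕ → ℤ) → Set
IsBindingFunction 𝒢 f = ∀ {n} (G : Graph n) → 𝒢 G → ∀ (S : Subset n) → tw (G [ S ]) ℤ.≤ f (ω (G [ S ]))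

IsTwωBounded : GraphClass → Set
IsTwωBounded 𝒢 = ∃[ f ] IsBindingFunction 𝒢 f

TreeAlphaAtMost : ℕ → GraphClass
TreeAlphaAtMost k G = tree-α G ≤ k

ramseyBinding : ℕ → ℕ → ℤ
ramseyBinding k p = + R (p + 1) (k + 1) ℤ.- + 2

------------------------------------------------------------------------
-- Rational polynomials, as coefficient vectors with the constant term first

eval : ∀ {m} → Vec ℚ m → ℚ → ℚ
eval []       x = 0ℚ
eval (a ∷ as) x = a ℚ.+ x ℚ.* eval as x

record Polynomial (d : ℕ) : Set where
  field
    coefficients : Vec ℚ (suc d)
    leading≢0    : Vec.last coefficients ≢ 0ℚ

-- f is bounded above, at every p : ℕ, by a polynomial of degree d.
BoundedByPolynomialOfDegree : ℕ → (ℕ → ℤ) → Set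
BoundedByPolynomialOfDegree d f =
  Σ (Polynomial d) λ P → ∀ p → f p ℚ./ 1 ℚ.≤ eval (Polynomial.coefficients P) (+ p ℚ./ 1)

{-# OPTIONS --safe #-}
-- Restrict a tree decomposition of G whose bags have independence number at most k to the
-- induced subgraph H = G[S].  A bag with at least R(ω(H)+1, k+1) vertices would contain a clique
-- of size ω(H)+1 or an independent set of size k+1, and both are excluded.  The polynomial bound
-- is R(p+1, k+1) ≤ (1+p)^k, by the Erdős–Szekeres induction on the (non-)neighbours of a vertex;
-- the induction closes because (1+p)^(q+1) + (2+p)^q ≤ (2+p)^(q+1).
module Submission where

open import Defs
open import Data.Fin using (Fin; zero; suc)
open import Data.Fin.Subset using (Subset; inside; outside; _∈_; _⊆_; ∣_∣; ⊥; ⊤; ⁅_⁆; _∪_; _∩_; _-_; ∁)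
open import Data.Fin.Subset.Properties using (drop-∷-⊆; ⊥⊆; ∣⊥∣≡0; ∣⊤∣≡n; x∈⁅y⁆⇒x≡y; x∈p∪q⁻; p∩q⊆p; p∩q⊆q; p─q⊆p)
open import Data.Integer as ℤ using (ℤ; +_; +≤+)
import Data.Integer.Properties as ℤ
open import Data.Nat using (ℕ; zero; suc; _+_; _*_; _^_; _≤_; _<_; s≤s; s≤s⁻¹; NonZero)
import Data.Nat.Coprimality as Coprime
import Data.Nat.Properties as ℕ
open import Data.Product using (∃-syntax; _×_; _,_; proj₁; proj₂)
open import Data.Rational as ℚ using (ℚ; mkℚ; 0ℚ; 1ℚ)
import Data.Rational.Properties as ℚ
open import Data.Rational.Solver using (module +-*-Solver)
open import Data.Sum as Sum using (_⊎_; inj₁; inj₂)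
open import Data.Vec as Vec using (Vec; []; _∷_; lookup; here; there)
import Data.Vec.Properties as Vec
open import Function using (_∘_)
open import Relation.Binary.PropositionalEquality using (_≡_; refl; sym; trans; cong; cong₂; subst; subst₂; module ≡-Reasoning)
open import Relation.Nullary using (¬_; contradiction)

-- Cliques and independent sets in subsets and in induced subgraphs

CliqueIn : ∀ {n} → Graph n → Subset n → ℕ → Set
CliqueIn G S p = ∃[ C ] (C ⊆ S × IsClique G C × ∣ C ∣ ≡ p)

IndependentIn : ∀ {n} → Graph n → Subset n → ℕ → Set
IndependentIn G S q = ∃[ C ] (C ⊆ S × IsIndependent G C × ∣ C ∣ ≡ q)

-- The image of `C` under `member S`.
extend : ∀ {n} (S : Subset n) → Subset ∣ S ∣ → Subset n
extend []            []      = []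
extend (outside ∷ S) C       = outside ∷ extend S C
extend (inside  ∷ S) (c ∷ C) = c ∷ extend S C

∣extend∣ : ∀ {n} (S : Subset n) C → ∣ extend S C ∣ ≡ ∣ C ∣
∣extend∣ []            []            = refl
∣extend∣ (outside ∷ S) C             = ∣extend∣ S C
∣extend∣ (inside  ∷ S) (inside  ∷ C) = cong suc (∣extend∣ S C)
∣extend∣ (inside  ∷ S) (outside ∷ C) = ∣extend∣ S C

∈-extend⁻ : ∀ {n} (S : Subset n) C {u} → u ∈ extend S C → ∃[ i ] (i ∈ C × member S i ≡ u)
∈-extend⁻ (outside ∷ S) C (there u∈) with ∈-extend⁻ S C u∈
... | i , i∈ , refl = i , i∈ , refl
∈-extend⁻ (inside ∷ S) (inside ∷ C) here = zero , here , refl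
∈-extend⁻ (inside ∷ S) (c ∷ C) (there u∈) with ∈-extend⁻ S C u∈
... | i , i∈ , refl = suc i , there i∈ , refl

-- The preimage of `A` under `member S`, that is, `A ∩ S` with its vertices renamed.
restrict : ∀ {n} (S : Subset n) → Subset n → Subset ∣ S ∣
restrict []            []      = []
restrict (outside ∷ S) (_ ∷ A) = restrict S A
restrict (inside  ∷ S) (a ∷ A) = a ∷ restrict S A

lookup-restrict : ∀ {n} (S A : Subset n) i → lookup (restrict S A) i ≡ lookup A (member S i)
lookup-restrict (outside ∷ S) (_ ∷ A) i       = lookup-restrict S A i
lookup-restrict (inside  ∷ S) (_ ∷ A) zero    = refl
lookup-restrict (inside  ∷ S) (_ ∷ A) (suc i) = lookup-restrict S A i

∈-restrict⁺ : ∀ {n} (S A : Subset n) {i} → member S i ∈ A → i ∈ restrict S A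
∈-restrict⁺ S A {i} p = Vec.lookup⇒[]= i _ (trans (lookup-restrict S A i) (Vec.[]=⇒lookup p))

∈-restrict⁻ : ∀ {n} (S A : Subset n) {i} → i ∈ restrict S A → member S i ∈ A
∈-restrict⁻ S A {i} p = Vec.lookup⇒[]= _ A (trans (sym (lookup-restrict S A i)) (Vec.[]=⇒lookup p))

∣restrict∣ : ∀ {n} (S A : Subset n) → A ⊆ S → ∣ restrict S A ∣ ≡ ∣ A ∣
∣restrict∣ []            []            A⊆S = refl
∣restrict∣ (outside ∷ S) (inside  ∷ A) A⊆S with () ← A⊆S here
∣restrict∣ (outside ∷ S) (outside ∷ A) A⊆S = ∣restrict∣ S A (drop-∷-⊆ A⊆S)
∣restrict∣ (inside  ∷ S) (inside  ∷ A) A⊆S = cong suc (∣restrict∣ S A (drop-∷-⊆ A⊆S))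
∣restrict∣ (inside  ∷ S) (outside ∷ A) A⊆S = ∣restrict∣ S A (drop-∷-⊆ A⊆S)

extend-⊆ : ∀ {n} (S : Subset n) C {A} → C ⊆ restrict S A → extend S C ⊆ A
extend-⊆ S C {A} C⊆ u∈ with ∈-extend⁻ S C u∈
... | i , i∈ , refl = ∈-restrict⁻ S A (C⊆ i∈)

module _ {n} (G : Graph n) (S : Subset n) where

  extend-clique : ∀ {C} → IsClique (G [ S ]) C → IsClique G (extend S C)
  extend-clique {C} c u v u∈ v∈ u≢v with ∈-extend⁻ S C u∈ | ∈-extend⁻ S C v∈
  ... | i , i∈ , refl | j , j∈ , refl = c i j i∈ j∈ (u≢v ∘ cong (member S))

  extend-independent : ∀ {C} → IsIndependent (G [ S ]) C → IsIndependent G (extend S C)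
  extend-independent {C} c u v u∈ v∈ with ∈-extend⁻ S C u∈ | ∈-extend⁻ S C v∈
  ... | i , i∈ , refl | j , j∈ , refl = c i j i∈ j∈

  restrict-independent : ∀ {A} → IsIndependent G A → IsIndependent (G [ S ]) (restrict S A)
  restrict-independent {A} c i j i∈ j∈ = c _ _ (∈-restrict⁻ S A i∈) (∈-restrict⁻ S A j∈)

clique≤ω : ∀ {n} (G : Graph n) {C} → IsClique G C → ∣ C ∣ ≤ ω G
clique≤ω G c = proj₂ (proj₂ (cliqueNumber-exists G)) (_ , c)

independent≤α : ∀ {n} (G : Graph n) {C} → IsIndependent G C → ∣ C ∣ ≤ α G
independent≤α G c = proj₂ (proj₂ (independenceNumber-exists G)) (_ , c)

-- Restricting a tree decomposition to an induced subgraph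

module _ {n} {G : Graph n} (S : Subset n) (𝒯 : TreeDecomposition G) where

  restrictedBag : Fin (nodes 𝒯) → Subset ∣ S ∣
  restrictedBag t = restrict S (bag 𝒯 t)

  restrictDecomposition : TreeDecomposition (G [ S ])
  restrictDecomposition = record
    { nodes = nodes 𝒯
    ; tree = tree 𝒯
    ; bag = restrictedBag
    ; isTreeDecomposition = record
      { isTree = isTree
      ; covers-vertices = λ u → let (t , p) = covers-vertices (member S u) in
          t , ∈-restrict⁺ S (bag 𝒯 t) p
      ; covers-edges = λ u v a → let (t , p , q) = covers-edges (member S u) (member S v) a in
          t , ∈-restrict⁺ S (bag 𝒯 t) p , ∈-restrict⁺ S (bag 𝒯 t) q
      -- The tree is unchanged and `u` occupies exactly the nodes that `member S u` occupied before,
      -- so connectivity is carried over along an equality of node sets.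
      ; connected-subtree = λ u → subst (λ A → Connected (tree 𝒯 [ A ]))
          (Vec.tabulate-cong λ t → sym (lookup-restrict S (bag 𝒯 t) u))
          (connected-subtree (member S u))
      }
    }
    where open IsTreeDecomposition (isTreeDecomposition 𝒯)

-- Bag sizes and the binding function

R-property : ∀ p q → RamseyProperty p q (R p q)
R-property p q = proj₂ (proj₁ (proj₂ (ramseyNumber-exists p q)))

1≤R : ∀ p q → 1 ≤ R p q
1≤R p q = proj₁ (proj₁ (proj₂ (ramseyNumber-exists p q)))

R-least : ∀ p q M → 1 ≤ M → RamseyProperty p q M → R p q ≤ M
R-least p q = proj₂ (proj₂ (ramseyNumber-exists p q))

restrictedBag<R : ∀ {n} {G : Graph n} (S : Subset n) (𝒯 : TreeDecomposition G) {k} → αᵗ 𝒯 ≤ k →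
                  ∀ t → ∣ restrictedBag S 𝒯 t ∣ < R (ω (G [ S ]) + 1) (k + 1)
restrictedBag<R {G = G} S 𝒯 {k} αᵗ≤k t = ℕ.≰⇒> λ R≤ → absurd (R-property _ _ (G [ S ] [ Y ]) R≤)
  where
  X = bag 𝒯 t
  Y = restrictedBag S 𝒯 t

  n+1≰n : ∀ {m} → ¬ m + 1 ≤ m
  n+1≰n {m} le = ℕ.1+n≰n (subst (_≤ m) (ℕ.+-comm m 1) le)

  absurd : ¬ HasCliqueOrIndependent (ω (G [ S ]) + 1) (k + 1) (G [ S ] [ Y ])
  absurd (inj₁ (C , c , e)) = n+1≰n (subst (_≤ ω (G [ S ])) (trans (∣extend∣ Y C) e)
    (clique≤ω (G [ S ]) (extend-clique (G [ S ]) Y c)))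
  -- `αᵗ` measures independence in `G [ X ]`, whereas `C` lives in `G [ S ] [ Y ]`. So `C` is lifted
  -- in two stages to a set `E` of vertices of `G`, which lies in `X`, and then pulled back to
  -- `G [ X ]`.
  absurd (inj₂ (C , c , e)) = n+1≰n (begin
    k + 1           ≡⟨ e ⟨
    ∣ C ∣           ≡⟨ ∣extend∣ Y C ⟨
    ∣ D ∣           ≡⟨ ∣extend∣ S D ⟨
    ∣ E ∣           ≡⟨ ∣restrict∣ X E E⊆X ⟨
    ∣ restrict X E ∣ ≤⟨ independent≤α (G [ X ]) (restrict-independent G X
                          (extend-independent G S (extend-independent (G [ S ]) Y c))) ⟩
    α (G [ X ])     ≤⟨ ≤maxOver (λ t → α (G [ bag 𝒯 t ])) t ⟩
    αᵗ 𝒯            ≤⟨ αᵗ≤k ⟩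
    k               ∎)
    where
    open ℕ.≤-Reasoning
    D = extend Y C
    E = extend S D
    E⊆X : E ⊆ X
    E⊆X = extend-⊆ S D λ u∈ → let (i , _ , eq) = ∈-extend⁻ Y C u∈ in subst (_∈ Y) eq (member-∈ Y i)

-- `1 ≤ m` takes care of the default value 0 in `maxOver`.
maxOver< : ∀ {n} (f : Fin n → ℕ) {m} → 1 ≤ m → (∀ i → f i < m) → maxOver f < m
maxOver< f (s≤s _) h = s≤s (maxOver≤ f (s≤s⁻¹ ∘ h))

-- The source of the 2 in `ramseyBinding`: one unit comes from the definition of width, the other
-- from the strictness of the bound on bag sizes.
m<n⇒m-1≤n-2 : ∀ {m n} → m < n → + m ℤ.- + 1 ℤ.≤ + n ℤ.- + 2
m<n⇒m-1≤n-2 {m} {n} m<n = begin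
  m ℤ.⊖ 1     ≡⟨ ℤ.[1+m]⊖[1+n]≡m⊖n m 1 ⟨
  suc m ℤ.⊖ 2 ≤⟨ ℤ.⊖-monoˡ-≤ 2 m<n ⟩
  n ℤ.⊖ 2     ∎
  where open ℤ.≤-Reasoning

ramseyBinding-binds : ∀ k → IsBindingFunction (TreeAlphaAtMost k) (ramseyBinding k)
ramseyBinding-binds k G tree-α≤k S with treeIndependenceNumber-exists G
-- Here `𝒯` is an optimal decomposition: matching on `refl` turns the hypothesis on `tree-α G` into
-- `αᵗ 𝒯 ≤ k`.
... | _ , (𝒯 , refl) , _ = ℤ.≤-trans
  (proj₂ (proj₂ (treewidth-exists (G [ S ]))) (restrictDecomposition S 𝒯))
  (m<n⇒m-1≤n-2 (maxOver< _ (1≤R (ω (G [ S ]) + 1) (k + 1)) (restrictedBag<R S 𝒯 tree-α≤k)))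

-- The Erdős-Szekeres induction

module _ {n} (G : Graph n) {S : Subset n} {v : Fin n} (v∈S : v ∈ S) where

  insert-⊆ : ∀ {C} → C ⊆ S - v → ⁅ v ⁆ ∪ C ⊆ S
  insert-⊆ {C} s i with x∈p∪q⁻ ⁅ v ⁆ C i
  ... | inj₁ j = subst (_∈ S) (sym (x∈⁅y⁆⇒x≡y v j)) v∈S
  ... | inj₂ j = p─q⊆p S ⁅ v ⁆ (s j)

  ∣insert∣ : ∀ {C p} → C ⊆ S - v → ∣ C ∣ ≡ p → ∣ ⁅ v ⁆ ∪ C ∣ ≡ suc p
  ∣insert∣ {C} s e = trans (∣⁅x⁆∪p∣≡1+∣p∣ C (x∉p-x S ∘ s)) (cong suc e)

  cliqueIn-suc : ∀ {p} → CliqueIn G ((S - v) ∩ neighbours G v) p → CliqueIn G S (suc p)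
  cliqueIn-suc (C , s , c , e) =
    ⁅ v ⁆ ∪ C , insert-⊆ s₁ , clique-insert G c (λ x → p∩q⊆q _ _ (s x)) , ∣insert∣ s₁ e
    where
    s₁ : C ⊆ S - v
    s₁ x = p∩q⊆p _ _ (s x)

  independentIn-suc : ∀ {q} → IndependentIn G ((S - v) ∩ ∁ (neighbours G v)) q → IndependentIn G S (suc q)
  independentIn-suc (C , s , c , e) =
    ⁅ v ⁆ ∪ C , insert-⊆ s₁ , independent-insert G c (λ x → p∩q⊆q _ _ (s x)) , ∣insert∣ s₁ e
    where
    s₁ : C ⊆ S - v
    s₁ x = p∩q⊆p _ _ (s x)

  ∣neighbours∣+∣non-neighbours∣ :
    suc (∣ (S - v) ∩ neighbours G v ∣ + ∣ (S - v) ∩ ∁ (neighbours G v) ∣) ≡ ∣ S ∣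
  ∣neighbours∣+∣non-neighbours∣ =
    trans (cong suc (∣p∩q∣+∣p∩∁q∣≡∣p∣ (S - v) (neighbours G v))) (sym (∣p∣≡1+∣p-x∣ S v∈S))

  weaken : {P : Subset n → Set} {A : Subset n} → A ⊆ S - v → ∃[ C ] (C ⊆ A × P C) → ∃[ C ] (C ⊆ S × P C)
  weaken s (C , t , r) = C , (λ x → p─q⊆p S ⁅ v ⁆ (s (t x))) , r

-- The `suc` counts the chosen vertex, which is in neither part. If `a < r`, then
-- `r + s ≤ suc a + b ≤ r + b`, and `r` cancels.
split-sum : ∀ {a b r s} → r + s ≤ suc (a + b) → r ≤ a ⊎ s ≤ b
split-sum {a} {b} {r} {s} h with ℕ.≤-<-connex r a
... | inj₁ r≤a = inj₁ r≤a
... | inj₂ a<r = inj₂ (ℕ.+-cancelˡ-≤ r _ _ (ℕ.≤-trans h (ℕ.+-monoˡ-≤ b a<r)))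

-- Raising the base of `suc p ^ q` to `suc (suc p)` makes the left side `suc p` copies plus one copy
-- of `suc (suc p) ^ q`.
power-step : ∀ p q → suc p ^ suc q + suc (suc p) ^ q ≤ suc (suc p) ^ suc q
power-step p q = begin
  suc p * suc p ^ q + suc (suc p) ^ q       ≤⟨ ℕ.+-monoˡ-≤ _ (ℕ.*-monoʳ-≤ (suc p) (ℕ.^-monoˡ-≤ q (ℕ.n≤1+n (suc p)))) ⟩
  suc p * suc (suc p) ^ q + suc (suc p) ^ q ≡⟨ ℕ.+-comm _ (suc (suc p) ^ q) ⟩
  suc (suc p) ^ suc q                       ∎
  where open ℕ.≤-Reasoning

-- Stated for a subset `S` so that the induction can pass to the neighbours or the non-neighbours of
-- `v`; the first call lowers `p`, the second lowers `q`. By `power-step` and `split-sum`, one of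
-- the two parts is large enough.
ramsey-power : ∀ {n} (G : Graph n) p q S → suc p ^ q ≤ ∣ S ∣ → CliqueIn G S (suc p) ⊎ IndependentIn G S (suc q)
ramsey-power {n} G p q S h with 0<∣p∣⇒nonempty S (ℕ.≤-trans (ℕ.m^n>0 (suc p) q) h)
-- In both base cases the required set has one element, and `v` alone serves.
ramsey-power {n} G zero q S h | v , v∈ = inj₁ (cliqueIn-suc G v∈ (⊥ , ⊥⊆ , clique-⊥ G , ∣⊥∣≡0 n))
ramsey-power {n} G (suc p) zero S h | v , v∈ = inj₂ (independentIn-suc G v∈ (⊥ , ⊥⊆ , independent-⊥ G , ∣⊥∣≡0 n))
ramsey-power {n} G (suc p) (suc q) S h | v , v∈
  with split-sum (ℕ.≤-trans (ℕ.≤-trans (power-step p q) h) (ℕ.≤-reflexive (sym (∣neighbours∣+∣non-neighbours∣ G v∈))))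
... | inj₁ h₁ with ramsey-power G p (suc q) _ h₁
...   | inj₁ c = inj₁ (cliqueIn-suc G v∈ c)
...   | inj₂ i = inj₂ (weaken G v∈ (p∩q⊆p _ _) i)
ramsey-power {n} G (suc p) (suc q) S h | v , v∈ | inj₂ h₂ with ramsey-power G (suc p) q _ h₂
...   | inj₁ c = inj₁ (weaken G v∈ (p∩q⊆p _ _) c)
...   | inj₂ i = inj₂ (independentIn-suc G v∈ i)

R≤power : ∀ p q → R (suc p) (suc q) ≤ suc p ^ q
R≤power p q = R-least (suc p) (suc q) _ (ℕ.m^n>0 (suc p) q) λ {n} G le →
  Sum.map (λ (C , _ , r) → C , r) (λ (C , _ , r) → C , r)
    (ramsey-power G p q ⊤ (subst (_ ≤_) (sym (∣⊤∣≡n n)) le))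

-- The coefficients of the k-th power of 1 + x

-- The coefficients of `c + (1 + x) A(x)`, where `as` are those of `A`. The summand `c` acts as a
-- carry: `c + (1 + x)(a + x B) = (c + a) + x (a + (1 + x) B)`.
_+[1+x]·_ : ∀ {m} → ℚ → Vec ℚ m → Vec ℚ (suc m)
c +[1+x]· []       = c ∷ []
c +[1+x]· (a ∷ as) = (c ℚ.+ a) ∷ (a +[1+x]· as)

eval-+[1+x]· : ∀ {m} c (as : Vec ℚ m) x → eval (c +[1+x]· as) x ≡ c ℚ.+ (1ℚ ℚ.+ x) ℚ.* eval as x
eval-+[1+x]· c []       x = solve 2 (λ c x → c :+ x :* con 0ℚ := c :+ (con 1ℚ :+ x) :* con 0ℚ) refl c x
  where open +-*-Solver
eval-+[1+x]· c (a ∷ as) x = trans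
  (cong (λ e → c ℚ.+ a ℚ.+ x ℚ.* e) (eval-+[1+x]· a as x))
  (solve 4 (λ c a x e → c :+ a :+ x :* (a :+ (con 1ℚ :+ x) :* e) := c :+ (con 1ℚ :+ x) :* (a :+ x :* e))
    refl c a x (eval as x))
  where open +-*-Solver

last-+[1+x]· : ∀ {m} c (as : Vec ℚ (suc m)) → Vec.last (c +[1+x]· as) ≡ Vec.last as
last-+[1+x]· c (a ∷ [])     = refl
last-+[1+x]· c (a ∷ b ∷ as) = last-+[1+x]· a (b ∷ as)

binomialCoefficients : ∀ k → Vec ℚ (suc k)
binomialCoefficients zero    = 1ℚ ∷ []
binomialCoefficients (suc k) = 0ℚ +[1+x]· binomialCoefficients k

last-binomialCoefficients : ∀ k → Vec.last (binomialCoefficients k) ≡ 1ℚ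
last-binomialCoefficients zero    = refl
last-binomialCoefficients (suc k) = trans (last-+[1+x]· 0ℚ (binomialCoefficients k)) (last-binomialCoefficients k)

-- Integers as rationals

-- `i / 1` normalises by a gcd and is stuck for a variable `i`. This form is already reduced, so
-- rational `+`, `*` and `≤` unfold on it.
fromℤ : ℤ → ℚ
fromℤ i = mkℚ i 0 (Coprime.sym (Coprime.1-coprimeTo ℤ.∣ i ∣))

/1≡fromℤ : ∀ i → i ℚ./ 1 ≡ fromℤ i
/1≡fromℤ i = ℚ.↥p/↧p≡p (fromℤ i)

/1-homo-+ : ∀ i j → (i ℤ.+ j) ℚ./ 1 ≡ i ℚ./ 1 ℚ.+ j ℚ./ 1
/1-homo-+ i j = trans
  -- The sum of `fromℤ i` and `fromℤ j` unfolds to a fraction with numerator `i * + 1 + j * + 1`.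
  (cong (ℚ._/ 1) (sym (cong₂ ℤ._+_ (ℤ.*-identityʳ i) (ℤ.*-identityʳ j))))
  (sym (cong₂ ℚ._+_ (/1≡fromℤ i) (/1≡fromℤ j)))

/1-homo-* : ∀ i j → (i ℤ.* j) ℚ./ 1 ≡ i ℚ./ 1 ℚ.* (j ℚ./ 1)
/1-homo-* i j = sym (cong₂ ℚ._*_ (/1≡fromℤ i) (/1≡fromℤ j))

/1-mono-≤ : ∀ {i j} → i ℤ.≤ j → i ℚ./ 1 ℚ.≤ j ℚ./ 1
/1-mono-≤ {i} {j} i≤j = subst₂ ℚ._≤_ (sym (/1≡fromℤ i)) (sym (/1≡fromℤ j))
  (ℚ.*≤* (ℤ.*-monoʳ-≤-nonNeg (+ 1) i≤j))

eval-binomialCoefficients : ∀ k p → eval (binomialCoefficients k) (+ p ℚ./ 1) ≡ + (suc p ^ k) ℚ./ 1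
eval-binomialCoefficients zero    p = trans (cong (1ℚ ℚ.+_) (ℚ.*-zeroʳ (+ p ℚ./ 1))) (ℚ.+-identityʳ 1ℚ)
eval-binomialCoefficients (suc k) p = begin
  eval (binomialCoefficients (suc k)) x              ≡⟨ eval-+[1+x]· 0ℚ (binomialCoefficients k) x ⟩
  0ℚ ℚ.+ (1ℚ ℚ.+ x) ℚ.* eval (binomialCoefficients k) x ≡⟨ ℚ.+-identityˡ _ ⟩
  (1ℚ ℚ.+ x) ℚ.* eval (binomialCoefficients k) x     ≡⟨ cong₂ ℚ._*_ (sym (/1-homo-+ (+ 1) (+ p))) (eval-binomialCoefficients k p) ⟩
  + suc p ℚ./ 1 ℚ.* (+ (suc p ^ k) ℚ./ 1)            ≡⟨ /1-homo-* (+ suc p) (+ (suc p ^ k)) ⟨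
  (+ suc p ℤ.* + (suc p ^ k)) ℚ./ 1                  ≡⟨ cong (ℚ._/ 1) (sym (ℤ.pos-* (suc p) (suc p ^ k))) ⟩
  + (suc p ^ suc k) ℚ./ 1                            ∎
  where
  open ≡-Reasoning
  x = + p ℚ./ 1

-- The polynomial bound and the conclusion

ramseyBinding≤power : ∀ k p → ramseyBinding k p ℤ.≤ + (suc p ^ k)
-- The rewriting brings `R (p + 1) (k + 1)` into the successor form of `R≤power`; the subtracted 2
-- is then simply dropped.
ramseyBinding≤power k p rewrite ℕ.+-comm p 1 | ℕ.+-comm k 1 =
  ℤ.i≤j⇒i-k≤j (+ 2) (+≤+ (R≤power p k))

ramseyBinding-polynomial : ∀ k → BoundedByPolynomialOfDegree k (ramseyBinding k)
ramseyBinding-polynomial k =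
  record { coefficients = binomialCoefficients k
         ; leading≢0 = λ e → contradiction (trans (sym (last-binomialCoefficients k)) e) λ () }
  , λ p → subst (ramseyBinding k p ℚ./ 1 ℚ.≤_) (sym (eval-binomialCoefficients k p))
            (/1-mono-≤ (ramseyBinding≤power k p))

lemma3p2 : (k : ℕ) → .{{_ : NonZero k}} →
    IsTwωBounded (TreeAlphaAtMost k)
    × IsBindingFunction (TreeAlphaAtMost k) (ramseyBinding k)
    × BoundedByPolynomialOfDegree k (ramseyBinding k)
lemma3p2 k = (ramseyBinding k , ramseyBinding-binds k) , ramseyBinding-binds k , ramseyBinding-polynomial k
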